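{- If the sequent $\Phi\Rightarrow\Psi$ has a co-proof in $\mathsf{K}\mu_\omega$, then $\bigwedge\Phi\to\bigvee\Psi$ is valid, i.e. every model satisfying (at its root) all formulas of $\Phi$ satisfies some formula of $\Psi$.
   Context: Formulas ($\mathsf{L}_\mu$): built from variables $x$ and negated variables $\neg x$ (literals) by $\square\alpha$, $\diamond\alpha$, $\bigwedge\Gamma$, $\bigvee\Gamma$ ($\Gamma$ finite), $\mu\phi$, $\nu\phi$ where $\phi=\lambda x.\alpha$ with $\neg x$ not occurring in $\alpha$; $\phi\beta:=\alpha[x:=\beta]$; $\top=\bigwedge\emptyset$, $\bot=\bigvee\emptyset$; $\alpha^\bot$ is the dual (negation) obtained by swapping $x/\neg x$, $\bigwedge/\bigvee$, $\square/\diamond$, $\mu/\nu$ (with $(\mu\lambda x.\alpha)^\bot=\nu\lambda x.(\alpha[x:=\neg x])^\bot$). Semantics: standard semantics over tree-shaped Kripke models (a tree with a valuation of variables at each node), $\neg x$ true where $x$ is false, modalities over children, $\mu,\nu$ least/greatest fixed points; valid = true at the root of every model. Immediate subformula $\alpha\rhd\beta$: $\beta\in\Gamma$ for $\alpha=\bigwedge\Gamma,\bigvee\Gamma$; $\alpha=\square\beta,\diamond\beta$; or $\alpha=\sigma\phi$, $\beta=\phi(\sigma\phi)$. A thread is a sequence with $\alpha_i\rhd\alpha_{i+1}$. Complexity: literals $0$, $\mathrm{rk}(\triangle\alpha)=\mathrm{rk}(\alpha)+1$, $\mathrm{rk}(\bigcirc\Gamma)=\max_{\gamma\in\Gamma}\mathrm{rk}(\gamma)+1$,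 $\mathrm{rk}(\sigma\lambda x.\alpha)=\mathrm{rk}(\alpha)+1$. In an infinite thread the formulas occurring infinitely often have a unique one of minimal complexity, of form $\sigma\phi$; the thread is a $\nu$-thread if $\sigma=\nu$, else a $\mu$-thread. Sequents $\Phi\Rightarrow\Psi$ have finite sequences of formulas on each side. Rules of the calculus: structural rules exchange, contraction, weakening on either side; logical rules: ($\bigwedge$L) from $\gamma,\Phi\Rightarrow\Psi$ infer $\bigwedge\Gamma,\Phi\Rightarrow\Psi$ ($\gamma\in\Gamma$); ($\bigvee$L) from all $\gamma,\Phi\Rightarrow\Psi$ ($\gamma\in\Gamma$) infer $\bigvee\Gamma,\Phi\Rightarrow\Psi$; ($\sigma$L) from $\phi(\sigma\phi),\Phi\Rightarrow\Psi$ infer $\sigma\phi,\Phi\Rightarrow\Psi$; ($\diamond$L) from $\alpha,\Phi\Rightarrow\Psi$ infer $\diamond\alpha,\square\Phi\Rightarrow\diamond\Psi$; ($\bigwedge$R) from all $\Phi\Rightarrow\Psi,\gamma$ infer $\Phi\Rightarrow\Psi,\bigwedge\Gamma$; ($\bigvee$R) from $\Phi\Rightarrow\Psi,\gamma$ ($\gamma\in\Gamma$) infer $\Phi\Rightarrow\Psi,\bigvee\Gamma$; ($\sigma$R) from $\Phi\Rightarrow\Psi,\phi(\sigma\phi)$ infer $\Phi\Rightarrow\Psi,\sigma\phi$; ($\square$R) from $\Phi\Rightarrow\Psi,\alpha$ infer $\square\Phi\Rightarrow\diamond\Psi,\square\alpha$; axioms $x,\neg x\Rightarrow$, $\Rightarrow\neg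 x,x$ and $x\Rightarrow x$ for variables $x$. In each logical rule the displayed compound formula in the conclusion is principal and the displayed immediate subformula in a premise is minor. A trace along a branch of a derivation follows a formula occurrence upward: through a logical rule a principal occurrence moves to the minor occurrence and side occurrences move to their copies; through structural rules occurrences move to the corresponding occurrences. The thread supported by a trace records the formula each time it moves through a principal position (so consecutive formulas satisfy $\rhd$). A co-proof in $\mathsf{K}\mu_\omega$ is a (possibly infinite) tree of sequents built by these rules, all leaves being axioms, every infinite branch containing infinitely many logical rules, such that every infinite branch carries an infinite trace starting on the left whose thread is a $\mu$-thread or an infinite trace starting on the right whose thread is a $\nu$-thread. -}

module Defs where

open import Data.Empty using (⊥)
open import Data.Fin.Base using (Fin; zero; suc; lift)
open import Data.List.Base using (List; []; _∷_; map)
open import Data.List.Membership.Propositional using (_∈_)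
open import Data.List.Membership.Propositional.Properties using (∈-map⁺)
open import Data.List.Relation.Binary.Permutation.Propositional using (_↭_)
open import Data.List.Relation.Binary.Permutation.Propositional.Properties using (∈-resp-↭)
open import Data.List.Relation.Unary.Any using (here; there)
open import Data.Nat.Base using (ℕ; zero; suc; _+_; _⊔_; _≤_; _<_)
open import Data.Product.Base using (Σ; Σ-syntax; ∃; ∃-syntax; _×_; _,_; proj₁; proj₂)
open import Data.Sum.Base using (_⊎_)
open import Data.Unit.Base using (⊤)
open import Data.Vec.Functional using (Vector) renaming ([] to []ᵛ; _∷_ to _∷ᵛ_)
open import Function.Base using (_∘_)
open import Level using (Lift; 0ℓ) renaming (suc to lsuc)
open import Relation.Binary.Construct.Closure.ReflexiveTransitive using (Star)
open import Relation.Binary.Core using (Rel)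
open import Relation.Binary.PropositionalEquality.Core using (_≡_; refl)
open import Relation.Nullary.Negation.Core using (¬_)
open import Relation.Unary using (Pred)

------------------------------------------------------------------------
-- Formulas

Var : Set
Var = ℕ

data Binder : Set where
  μ ν : Binder

-- Formulas up to renaming of bound variables.  Free variables are the
-- literals `pos x` and `neg x`; the variables bound by an enclosing
-- fixed point are de Bruijn indices.  A bound variable has no negated
-- form, so that ¬x does not occur in α for every σ(λx.α).

data Form (n : ℕ) : Set where
  pos neg : Var → Form n
  bvar    : Fin n → Form n
  □ ◇     : Form n → Form n
  ⋀ ⋁     : List (Form n) → Form n
  fix     : Binder → Form (suc n) → Form n

Formula : Set
Formula = Form 0

private
  variable
    m n : ℕ

mutual
  ren : (Fin m → Fin n) → Form m → Form n
  ren ρ (pos x)   = pos x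
  ren ρ (neg x)   = neg x
  ren ρ (bvar i)  = bvar (ρ i)
  ren ρ (□ α)     = □ (ren ρ α)
  ren ρ (◇ α)     = ◇ (ren ρ α)
  ren ρ (⋀ Γ)     = ⋀ (rens ρ Γ)
  ren ρ (⋁ Γ)     = ⋁ (rens ρ Γ)
  ren ρ (fix σ α) = fix σ (ren (lift 1 ρ) α)

  rens : (Fin m → Fin n) → List (Form m) → List (Form n)
  rens ρ []      = []
  rens ρ (α ∷ Γ) = ren ρ α ∷ rens ρ Γ

liftSub : (Fin m → Form n) → Fin (suc m) → Form (suc n)
liftSub θ zero    = bvar zero
liftSub θ (suc i) = ren suc (θ i)

mutual
  sub : (Fin m → Form n) → Form m → Form n
  sub θ (pos x)   = pos x
  sub θ (neg x)   = neg x
  sub θ (bvar i)  = θ i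
  sub θ (□ α)     = □ (sub θ α)
  sub θ (◇ α)     = ◇ (sub θ α)
  sub θ (⋀ Γ)     = ⋀ (subs θ Γ)
  sub θ (⋁ Γ)     = ⋁ (subs θ Γ)
  sub θ (fix σ α) = fix σ (sub (liftSub θ) α)

  subs : (Fin m → Form n) → List (Form m) → List (Form n)
  subs θ []      = []
  subs θ (α ∷ Γ) = sub θ α ∷ subs θ Γ

-- α [ β ] is φβ for φ = λx.α.

infix 9 _[_]

_[_] : Form (suc n) → Form n → Form n
α [ β ] = sub (β ∷ᵛ bvar) α

mutual
  rk : Form n → ℕ
  rk (pos x)   = 0
  rk (neg x)   = 0
  rk (bvar i)  = 0
  rk (□ α)     = suc (rk α)
  rk (◇ α)     = suc (rk α)
  rk (⋀ Γ)     = suc (maxRk Γ)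
  rk (⋁ Γ)     = suc (maxRk Γ)
  rk (fix σ α) = suc (rk α)

  maxRk : List (Form n) → ℕ
  maxRk []      = 0
  maxRk (α ∷ Γ) = rk α ⊔ maxRk Γ

------------------------------------------------------------------------
-- Semantics

-- A model is a rooted tree: there is exactly one path from the root to
-- each world.

record Model : Set₁ where
  field
    World  : Set
    _⟶_    : Rel World 0ℓ
    root   : World
    path   : ∀ w → Star _⟶_ root w
    unique : ∀ {w} (p : Star _⟶_ root w) → p ≡ path w
    val    : Var → Pred World 0ℓ

module Semantics (M : Model) where
  open Model M

  -- μ denotes the intersection of all pre-fixed points, ν the union of
  -- all post-fixed points.

  mutual
    ⟦_⟧ : Form n → Vector (Pred World 0ℓ) n → Pred World (lsuc 0ℓ)
    ⟦ pos x ⟧   ρ w = Lift _ (val x w)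
    ⟦ neg x ⟧   ρ w = Lift _ (¬ val x w)
    ⟦ bvar i ⟧  ρ w = Lift _ (ρ i w)
    ⟦ □ α ⟧     ρ w = ∀ v → w ⟶ v → ⟦ α ⟧ ρ v
    ⟦ ◇ α ⟧     ρ w = ∃[ v ] w ⟶ v × ⟦ α ⟧ ρ v
    ⟦ ⋀ Γ ⟧     ρ w = ⟦⋀ Γ ⟧ ρ w
    ⟦ ⋁ Γ ⟧     ρ w = ⟦⋁ Γ ⟧ ρ w
    ⟦ fix μ α ⟧ ρ w = (P : Pred World 0ℓ) →
                      (∀ v → ⟦ α ⟧ (P ∷ᵛ ρ) v → P v) → P w
    ⟦ fix ν α ⟧ ρ w = Σ[ P ∈ Pred World 0ℓ ]
                      (∀ v → P v → ⟦ α ⟧ (P ∷ᵛ ρ) v) × P w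

    ⟦⋀_⟧ : List (Form n) → Vector (Pred World 0ℓ) n → Pred World (lsuc 0ℓ)
    ⟦⋀ [] ⟧    ρ w = Lift _ ⊤
    ⟦⋀ α ∷ Γ ⟧ ρ w = ⟦ α ⟧ ρ w × ⟦⋀ Γ ⟧ ρ w

    ⟦⋁_⟧ : List (Form n) → Vector (Pred World 0ℓ) n → Pred World (lsuc 0ℓ)
    ⟦⋁ [] ⟧    ρ w = Lift _ ⊥
    ⟦⋁ α ∷ Γ ⟧ ρ w = ⟦ α ⟧ ρ w ⊎ ⟦⋁ Γ ⟧ ρ w

infix 4 _⊨_

_⊨_ : Model → Formula → Set₁
M ⊨ α = Semantics.⟦_⟧ M α []ᵛ (Model.root M)

------------------------------------------------------------------------
-- Threads

infix 4 _▷_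

data _▷_ : Formula → Formula → Set where
  ⋀▷   : ∀ {Γ β} → β ∈ Γ → ⋀ Γ ▷ β
  ⋁▷   : ∀ {Γ β} → β ∈ Γ → ⋁ Γ ▷ β
  □▷   : ∀ {β} → □ β ▷ β
  ◇▷   : ∀ {β} → ◇ β ▷ β
  fix▷ : ∀ {σ α} → fix σ α ▷ α [ fix σ α ]

InfinitelyOften : (ℕ → Formula) → Formula → Set
InfinitelyOften t α = ∀ k → ∃[ i ] k ≤ i × t i ≡ α

-- The infinite thread t is a σ-thread: the formula of minimal complexity
-- among those occurring infinitely often is bound by σ.

record IsThread (σ : Binder) (t : ℕ → Formula) : Set where
  field
    thread   : ∀ i → t i ▷ t (suc i)
    body     : Form 1
    infinite : InfinitelyOften t (fix σ body)
    minimal  : ∀ β → InfinitelyOften t β → rk (fix σ body) ≤ rk β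

------------------------------------------------------------------------
-- Sequents and rules

-- The right-hand side of a sequent is listed from right to left: the
-- sequent written Φ ⇒ Ψ,γ is Φ ⇒ γ ∷ Ψ.

infix 3 _⇒_

record Sequent : Set where
  constructor _⇒_
  field
    lhs rhs : List Formula

private
  variable
    S           : Sequent
    α γ         : Formula
    Γ Φ Φ′ Ψ Ψ′ : List Formula
    σ           : Binder
    φ           : Form 1

-- Formula occurrences in a list.

Occ : List Formula → Set
Occ Φ = ∃[ α ] α ∈ Φ

-- Rule S is the type of rule instances with conclusion S.

data Rule : Sequent → Set where
  exchangeL : Φ′ ↭ Φ → Rule (Φ ⇒ Ψ)
  exchangeR : Ψ′ ↭ Ψ → Rule (Φ ⇒ Ψ)
  contractL : Rule (γ ∷ Φ ⇒ Ψ)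
  contractR : Rule (Φ ⇒ γ ∷ Ψ)
  weakenL   : Rule (γ ∷ Φ ⇒ Ψ)
  weakenR   : Rule (Φ ⇒ γ ∷ Ψ)
  ⋀L        : γ ∈ Γ → Rule (⋀ Γ ∷ Φ ⇒ Ψ)
  ⋁L        : Rule (⋁ Γ ∷ Φ ⇒ Ψ)
  fixL      : Rule (fix σ φ ∷ Φ ⇒ Ψ)
  ◇L        : Rule (◇ α ∷ map □ Φ ⇒ map ◇ Ψ)
  ⋀R        : Rule (Φ ⇒ ⋀ Γ ∷ Ψ)
  ⋁R        : γ ∈ Γ → Rule (Φ ⇒ ⋁ Γ ∷ Ψ)
  fixR      : Rule (Φ ⇒ fix σ φ ∷ Ψ)
  □R        : Rule (map □ Φ ⇒ □ α ∷ map ◇ Ψ)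
  axiomL    : ∀ x → Rule (pos x ∷ neg x ∷ [] ⇒ [])
  axiomR    : ∀ x → Rule ([] ⇒ pos x ∷ neg x ∷ [])
  axiomLR   : ∀ x → Rule (pos x ∷ [] ⇒ pos x ∷ [])

-- The index type of the premises of a rule instance.

Premise : Rule S → Set
Premise (⋁L {Γ = Γ}) = Occ Γ
Premise (⋀R {Γ = Γ}) = Occ Γ
Premise (axiomL x)   = ⊥
Premise (axiomR x)   = ⊥
Premise (axiomLR x)  = ⊥
Premise _            = ⊤

premise : (r : Rule S) → Premise r → Sequent
premise (exchangeL {Φ′ = Φ′} {Ψ = Ψ} p) _              = Φ′ ⇒ Ψ
premise (exchangeR {Ψ′ = Ψ′} {Φ = Φ} p) _              = Φ ⇒ Ψ′
premise (contractL {γ = γ} {Φ = Φ} {Ψ = Ψ}) _          = γ ∷ γ ∷ Φ ⇒ Ψ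
premise (contractR {Φ = Φ} {γ = γ} {Ψ = Ψ}) _          = Φ ⇒ γ ∷ γ ∷ Ψ
premise (weakenL {Φ = Φ} {Ψ = Ψ}) _                    = Φ ⇒ Ψ
premise (weakenR {Φ = Φ} {Ψ = Ψ}) _                    = Φ ⇒ Ψ
premise (⋀L {γ = γ} {Φ = Φ} {Ψ = Ψ} _) _               = γ ∷ Φ ⇒ Ψ
premise (⋁L {Φ = Φ} {Ψ = Ψ}) (γ , _)                   = γ ∷ Φ ⇒ Ψ
premise (fixL {σ = σ} {φ = φ} {Φ = Φ} {Ψ = Ψ}) _       = φ [ fix σ φ ] ∷ Φ ⇒ Ψ
premise (◇L {α = α} {Φ = Φ} {Ψ = Ψ}) _                 = α ∷ Φ ⇒ Ψ
premise (⋀R {Φ = Φ} {Ψ = Ψ}) (γ , _)                   = Φ ⇒ γ ∷ Ψ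
premise (⋁R {γ = γ} {Φ = Φ} {Ψ = Ψ} _) _               = Φ ⇒ γ ∷ Ψ
premise (fixR {Φ = Φ} {σ = σ} {φ = φ} {Ψ = Ψ}) _       = Φ ⇒ φ [ fix σ φ ] ∷ Ψ
premise (□R {Φ = Φ} {α = α} {Ψ = Ψ}) _                 = Φ ⇒ α ∷ Ψ

data IsLogical : Rule S → Set where
  ⋀L   : {i : γ ∈ Γ} → IsLogical (⋀L {Φ = Φ} {Ψ = Ψ} i)
  ⋁L   : IsLogical (⋁L {Γ} {Φ} {Ψ})
  fixL : IsLogical (fixL {σ} {φ} {Φ} {Ψ})
  ◇L   : IsLogical (◇L {α} {Φ} {Ψ})
  ⋀R   : IsLogical (⋀R {Φ} {Γ} {Ψ})
  ⋁R   : {i : γ ∈ Γ} → IsLogical (⋁R {Φ = Φ} {Ψ = Ψ} i)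
  fixR : IsLogical (fixR {Φ} {σ} {φ} {Ψ})
  □R   : IsLogical (□R {Φ} {α} {Ψ})

------------------------------------------------------------------------
-- Correspondence of occurrences

data Side : Set where
  left right : Side

_at_ : Sequent → Side → List Formula
(Φ ⇒ Ψ) at left  = Φ
(Φ ⇒ Ψ) at right = Ψ

tailOcc : Occ Φ → Occ (α ∷ Φ)
tailOcc (β , p) = β , there p

replaceHead : Occ (γ ∷ Φ) → Occ (α ∷ Φ)
replaceHead {α = α} (_ , here _)  = α , here refl
replaceHead         (β , there p) = β , there p

mergeHead : Occ (γ ∷ γ ∷ Φ) → Occ (γ ∷ Φ)
mergeHead (β , here p)  = β , here p
mergeHead (β , there p) = β , p

mapOcc : (f : Formula → Formula) → Occ Φ → Occ (map f Φ)
mapOcc f (β , p) = f β , ∈-map⁺ f p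

mapTail : (f : Formula → Formula) → Occ (γ ∷ Φ) → Occ (α ∷ map f Φ)
mapTail {α = α} f (_ , here _)  = α , here refl
mapTail         f (β , there p) = tailOcc (mapOcc f (β , p))

permOcc : Φ′ ↭ Φ → Occ Φ′ → Occ Φ
permOcc p (β , q) = β , ∈-resp-↭ p q

-- Each occurrence in a premise comes from exactly one occurrence in the
-- conclusion (there is no cut), so the correspondence is a function from
-- premises to conclusions.  An occurrence in the conclusion may have
-- several successors (contraction) or none (weakening, and the principal
-- occurrence of an axiom).

origin : (r : Rule S) (i : Premise r) (s : Side) →
         Occ (premise r i at s) → Occ (S at s)
origin (exchangeL p) _ left  o = permOcc p o
origin (exchangeL p) _ right o = o
origin (exchangeR p) _ left  o = o
origin (exchangeR p) _ right o = permOcc p o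
origin contractL     _ left  o = mergeHead o
origin contractL     _ right o = o
origin contractR     _ left  o = o
origin contractR     _ right o = mergeHead o
origin weakenL       _ left  o = tailOcc o
origin weakenL       _ right o = o
origin weakenR       _ left  o = o
origin weakenR       _ right o = tailOcc o
origin (⋀L _)        _ left  o = replaceHead o
origin (⋀L _)        _ right o = o
origin ⋁L            _ left  o = replaceHead o
origin ⋁L            _ right o = o
origin fixL          _ left  o = replaceHead o
origin fixL          _ right o = o
origin ◇L            _ left  o = mapTail □ o
origin ◇L            _ right o = mapOcc ◇ o
origin ⋀R            _ left  o = o
origin ⋀R            _ right o = replaceHead o
origin (⋁R _)        _ left  o = o
origin (⋁R _)        _ right o = replaceHead o
origin fixR          _ left  o = o
origin fixR          _ right o = replaceHead o
origin □R            _ left  o = mapOcc □ o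
origin □R            _ right o = mapTail ◇ o

data IsHead : Occ Φ → Set where
  isHead : ∀ {p} → IsHead {α ∷ Φ} (γ , here p)

-- IsMinor r i s o: the premise occurrence o is minor, that is, o and
-- origin r i s o are a minor occurrence and its principal occurrence.
-- In the modal rules all formulas change and all occurrences are
-- principal, resp. minor; otherwise a thread would not be a ▷-sequence.

IsMinor : (r : Rule S) (i : Premise r) (s : Side) →
          Occ (premise r i at s) → Set
IsMinor (⋀L _) _ left  o = IsHead o
IsMinor ⋁L     _ left  o = IsHead o
IsMinor fixL   _ left  o = IsHead o
IsMinor ◇L     _ _     o = ⊤
IsMinor ⋀R     _ right o = IsHead o
IsMinor (⋁R _) _ right o = IsHead o
IsMinor fixR   _ right o = IsHead o
IsMinor □R     _ _     o = ⊤
IsMinor _      _ _     o = ⊥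

------------------------------------------------------------------------
-- Derivations, branches and traces

-- Possibly infinite trees built from the rules.  Leaves are the rule
-- instances without premises: the axioms, and ⋁L and ⋀R for Γ = ∅
-- (i.e. ⊥,Φ ⇒ Ψ and Φ ⇒ Ψ,⊤).

record Derivation (S : Sequent) : Set where
  coinductive
  field
    rule : Rule S
    next : (i : Premise rule) → Derivation (premise rule i)

open Derivation public

Node : Set
Node = Σ Sequent Derivation

data _↝_ : Node → Node → Set where
  child : {d : Derivation S} (i : Premise (rule d)) →
          (S , d) ↝ (premise (rule d) i , next d i)

LogicalAt : Node → Set
LogicalAt (_ , d) = IsLogical (rule d)

OccAt : Side → Node → Set
OccAt s (S , _) = Occ (S at s)

originAt : ∀ {u v} (s : Side) → u ↝ v → OccAt s v → OccAt s u
originAt s (child {d = d} i) o = origin (rule d) i s o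

PrincipalMove : ∀ {u v} (s : Side) → u ↝ v → OccAt s v → Set
PrincipalMove s (child {d = d} i) o = IsMinor (rule d) i s o

record Branch (d : Derivation S) : Set where
  field
    node  : ℕ → Node
    start : node 0 ≡ (S , d)
    step  : ∀ i → node i ↝ node (suc i)

module _ {d : Derivation S} (b : Branch d) where
  open Branch b

  -- An infinite trace, starting at an arbitrary node of the branch.

  record Trace (s : Side) : Set where
    field
      base    : ℕ
      occ     : ∀ i → OccAt s (node (i + base))
      follows : ∀ i → originAt s (step (i + base)) (occ (suc i)) ≡ occ i

    formula : ℕ → Formula
    formula i = proj₁ (occ i)

    Principal : ℕ → Set
    Principal i = PrincipalMove s (step (i + base)) (occ (suc i))

  -- t is the (infinite) thread supported by τ: `position` enumerates the
  -- positions at which τ moves through a principal occurrence.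

  record Supports {s : Side} (τ : Trace s) (t : ℕ → Formula) : Set where
    open Trace τ
    field
      position   : ℕ → ℕ
      increasing : ∀ k → position k < position (suc k)
      sound      : ∀ k → Principal (position k)
      complete   : ∀ i → Principal i → ∃[ k ] position k ≡ i
      records    : ∀ k → t k ≡ formula (position k)

  Carries : Side → Binder → Set
  Carries s σ = Σ[ τ ∈ Trace s ] ∃[ t ] Supports τ t × IsThread σ t

record CoProof (S : Sequent) : Set where
  field
    derivation : Derivation S
    logical    : (b : Branch derivation) →
                 ∀ k → ∃[ i ] k ≤ i × LogicalAt (Branch.node b i)
    progress   : (b : Branch derivation) →
                 Carries b left μ ⊎ Carries b right ν

{-# OPTIONS --safe #-}
module Submission where

-- Suppose the end sequent fails at the root of a model.  Every formula on
-- the left then has evidence for its truth and every formula on the right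
-- evidence for its falsity, and following the choices made by the
-- evidence yields a branch along which all sequents fail.  Consider a
-- trace of this branch, say on the left, and represent each formula of
-- its thread as a subformula whose bound variables stand for the fixed
-- points unfolded so far, the innermost last.  Since subformulas shrink,
-- there is an outermost fixed point X which from some point on is never
-- abandoned, and it is returned to infinitely often.  From then on every
-- formula of the thread other than X contains X, so it has greater
-- complexity; hence X is the formula that decides the type of the thread.
-- If it were a μ-formula, each return to X would pass to a subtree of a
-- well-founded tree.  On the right the roles of μ and ν are exchanged.

open import Defs
open import Axiom.ExcludedMiddle using (ExcludedMiddle)
open import Data.Empty using (⊥; ⊥-elim)
open import Data.Fin.Base as Fin using (Fin; zero; suc)
open import Data.List.Base using (List; []; _∷_)
open import Data.List.Membership.Propositional using (_∈_; lose)
open import Data.List.Relation.Unary.All using (All; lookup)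
open import Data.List.Relation.Unary.Any using (Any; here; there)
open import Data.Nat.Base using (ℕ; zero; suc; _+_; _⊔_; _≤_; _<_; z≤n; s≤s)
open import Data.Nat.Properties
open import Data.Product.Base using (Σ-syntax; ∃-syntax; _×_; _,_; proj₁; proj₂)
open import Data.Sum.Base using (_⊎_; inj₁; inj₂; [_,_]′)
open import Data.Unit.Base using (⊤; tt)
open import Data.Vec.Functional using (Vector) renaming ([] to []ᵛ; _∷_ to _∷ᵛ_)
open import Function.Base using (_∘_; id)
open import Level using (Lift; lift; lower; 0ℓ) renaming (suc to lsuc)
open import Relation.Binary.PropositionalEquality
  using (_≡_; refl; sym; trans; cong; cong₂; subst)
open import Relation.Nullary.Decidable.Core
  using (yes; no; True; toWitness; fromWitness; decidable-stable)
open import Relation.Nullary.Negation.Core using (¬_)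
open import Relation.Unary using (Pred)

private
  variable
    k m n : ℕ

-- Substitution

mutual
  -- Here and in the lemmas that follow the composite is a third map given by pointwise equations,
  -- so that passing under a binder needs no function extensionality.
  ren-ren : {ρ : Fin k → Fin m} {ρ′ : Fin m → Fin n} {ρ″ : Fin k → Fin n} →
            (∀ i → ρ′ (ρ i) ≡ ρ″ i) → ∀ α → ren ρ′ (ren ρ α) ≡ ren ρ″ α
  ren-ren h (pos x)   = refl
  ren-ren h (neg x)   = refl
  ren-ren h (bvar i)  = cong bvar (h i)
  ren-ren h (□ α)     = cong □ (ren-ren h α)
  ren-ren h (◇ α)     = cong ◇ (ren-ren h α)
  ren-ren h (⋀ Γ)     = cong ⋀ (rens-rens h Γ)
  ren-ren h (⋁ Γ)     = cong ⋁ (rens-rens h Γ)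
  ren-ren h (fix σ α) =
    cong (fix σ) (ren-ren (λ { zero → refl ; (suc i) → cong suc (h i) }) α)

  rens-rens : {ρ : Fin k → Fin m} {ρ′ : Fin m → Fin n} {ρ″ : Fin k → Fin n} →
              (∀ i → ρ′ (ρ i) ≡ ρ″ i) → ∀ Γ → rens ρ′ (rens ρ Γ) ≡ rens ρ″ Γ
  rens-rens h []      = refl
  rens-rens h (α ∷ Γ) = cong₂ _∷_ (ren-ren h α) (rens-rens h Γ)

mutual
  sub-ren : {ρ : Fin k → Fin m} {θ : Fin m → Form n} {θ′ : Fin k → Form n} →
            (∀ i → θ (ρ i) ≡ θ′ i) → ∀ α → sub θ (ren ρ α) ≡ sub θ′ α
  sub-ren h (pos x)   = refl
  sub-ren h (neg x)   = refl
  sub-ren h (bvar i)  = h i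
  sub-ren h (□ α)     = cong □ (sub-ren h α)
  sub-ren h (◇ α)     = cong ◇ (sub-ren h α)
  sub-ren h (⋀ Γ)     = cong ⋀ (subs-rens h Γ)
  sub-ren h (⋁ Γ)     = cong ⋁ (subs-rens h Γ)
  sub-ren h (fix σ α) =
    cong (fix σ) (sub-ren (λ { zero → refl ; (suc i) → cong (ren suc) (h i) }) α)

  subs-rens : {ρ : Fin k → Fin m} {θ : Fin m → Form n} {θ′ : Fin k → Form n} →
              (∀ i → θ (ρ i) ≡ θ′ i) → ∀ Γ → subs θ (rens ρ Γ) ≡ subs θ′ Γ
  subs-rens h []      = refl
  subs-rens h (α ∷ Γ) = cong₂ _∷_ (sub-ren h α) (subs-rens h Γ)

ren-liftSub : {ρ : Fin m → Fin n} {θ : Fin k → Form m} {θ′ : Fin k → Form n} →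
              (∀ i → ren ρ (θ i) ≡ θ′ i) →
              ∀ i → ren (Fin.lift 1 ρ) (liftSub θ i) ≡ liftSub θ′ i
ren-liftSub         h zero    = refl
ren-liftSub {θ = θ} h (suc i) =
  trans (ren-ren (λ _ → refl) (θ i))
        (trans (sym (ren-ren (λ _ → refl) (θ i))) (cong (ren suc) (h i)))

mutual
  ren-sub : {ρ : Fin m → Fin n} {θ : Fin k → Form m} {θ′ : Fin k → Form n} →
            (∀ i → ren ρ (θ i) ≡ θ′ i) → ∀ α → ren ρ (sub θ α) ≡ sub θ′ α
  ren-sub h (pos x)   = refl
  ren-sub h (neg x)   = refl
  ren-sub h (bvar i)  = h i
  ren-sub h (□ α)     = cong □ (ren-sub h α)
  ren-sub h (◇ α)     = cong ◇ (ren-sub h α)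
  ren-sub h (⋀ Γ)     = cong ⋀ (rens-subs h Γ)
  ren-sub h (⋁ Γ)     = cong ⋁ (rens-subs h Γ)
  ren-sub h (fix σ α) = cong (fix σ) (ren-sub (ren-liftSub h) α)

  rens-subs : {ρ : Fin m → Fin n} {θ : Fin k → Form m} {θ′ : Fin k → Form n} →
              (∀ i → ren ρ (θ i) ≡ θ′ i) → ∀ Γ → rens ρ (subs θ Γ) ≡ subs θ′ Γ
  rens-subs h []      = refl
  rens-subs h (α ∷ Γ) = cong₂ _∷_ (ren-sub h α) (rens-subs h Γ)

sub-liftSub : {θ′ : Fin m → Form n} {θ : Fin k → Form m} {θ″ : Fin k → Form n} →
              (∀ i → sub θ′ (θ i) ≡ θ″ i) →
              ∀ i → sub (liftSub θ′) (liftSub θ i) ≡ liftSub θ″ i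
sub-liftSub         h zero    = refl
sub-liftSub {θ = θ} h (suc i) =
  trans (sub-ren (λ _ → refl) (θ i))
        (trans (sym (ren-sub (λ _ → refl) (θ i))) (cong (ren suc) (h i)))

mutual
  sub-sub : {θ′ : Fin m → Form n} {θ : Fin k → Form m} {θ″ : Fin k → Form n} →
            (∀ i → sub θ′ (θ i) ≡ θ″ i) → ∀ α → sub θ′ (sub θ α) ≡ sub θ″ α
  sub-sub h (pos x)   = refl
  sub-sub h (neg x)   = refl
  sub-sub h (bvar i)  = h i
  sub-sub h (□ α)     = cong □ (sub-sub h α)
  sub-sub h (◇ α)     = cong ◇ (sub-sub h α)
  sub-sub h (⋀ Γ)     = cong ⋀ (subs-subs h Γ)
  sub-sub h (⋁ Γ)     = cong ⋁ (subs-subs h Γ)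
  sub-sub h (fix σ α) = cong (fix σ) (sub-sub (sub-liftSub h) α)

  subs-subs : {θ′ : Fin m → Form n} {θ : Fin k → Form m} {θ″ : Fin k → Form n} →
              (∀ i → sub θ′ (θ i) ≡ θ″ i) → ∀ Γ → subs θ′ (subs θ Γ) ≡ subs θ″ Γ
  subs-subs h []      = refl
  subs-subs h (α ∷ Γ) = cong₂ _∷_ (sub-sub h α) (subs-subs h Γ)

mutual
  sub-id : {θ : Fin n → Form n} → (∀ i → θ i ≡ bvar i) → ∀ α → sub θ α ≡ α
  sub-id h (pos x)   = refl
  sub-id h (neg x)   = refl
  sub-id h (bvar i)  = h i
  sub-id h (□ α)     = cong □ (sub-id h α)
  sub-id h (◇ α)     = cong ◇ (sub-id h α)
  sub-id h (⋀ Γ)     = cong ⋀ (subs-id h Γ)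
  sub-id h (⋁ Γ)     = cong ⋁ (subs-id h Γ)
  sub-id h (fix σ α) =
    cong (fix σ) (sub-id (λ { zero → refl ; (suc i) → cong (ren suc) (h i) }) α)

  subs-id : {θ : Fin n → Form n} → (∀ i → θ i ≡ bvar i) → ∀ Γ → subs θ Γ ≡ Γ
  subs-id h []      = refl
  subs-id h (α ∷ Γ) = cong₂ _∷_ (sub-id h α) (subs-id h Γ)

-- For a fixed point `α` with body `β`, unfolding after closing equals closing the body with one
-- more entry; so environments can grow in place of formulas.
sub-∷ : (α : Formula) (θ : Fin n → Formula) (β : Form (suc n)) →
        sub (liftSub θ) β [ α ] ≡ sub (α ∷ᵛ θ) β
sub-∷ α θ = sub-sub λ
  { zero    → refl
  ; (suc i) → trans (sub-ren (λ _ → refl) (θ i)) (sub-id (λ ()) (θ i)) }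

∈-subs⁺ : (θ : Fin m → Form n) {Γ : List (Form m)} {α : Form m} →
          α ∈ Γ → sub θ α ∈ subs θ Γ
∈-subs⁺ θ (here refl) = here refl
∈-subs⁺ θ (there i)   = there (∈-subs⁺ θ i)

∈-subs⁻ : (θ : Fin m → Form n) (Γ : List (Form m)) {β : Form n} →
          β ∈ subs θ Γ → ∃[ α ] α ∈ Γ × sub θ α ≡ β
∈-subs⁻ θ (α ∷ Γ) (here refl) = α , here refl , refl
∈-subs⁻ θ (α ∷ Γ) (there i) with ∈-subs⁻ θ Γ i
... | β , j , eq = β , there j , eq

-- Complexity

mutual
  rk-ren : (ρ : Fin m → Fin n) (α : Form m) → rk (ren ρ α) ≡ rk α
  rk-ren ρ (pos x)   = refl
  rk-ren ρ (neg x)   = refl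
  rk-ren ρ (bvar i)  = refl
  rk-ren ρ (□ α)     = cong suc (rk-ren ρ α)
  rk-ren ρ (◇ α)     = cong suc (rk-ren ρ α)
  rk-ren ρ (⋀ Γ)     = cong suc (maxRk-rens ρ Γ)
  rk-ren ρ (⋁ Γ)     = cong suc (maxRk-rens ρ Γ)
  rk-ren ρ (fix σ α) = cong suc (rk-ren (Fin.lift 1 ρ) α)

  maxRk-rens : (ρ : Fin m → Fin n) (Γ : List (Form m)) →
               maxRk (rens ρ Γ) ≡ maxRk Γ
  maxRk-rens ρ []      = refl
  maxRk-rens ρ (α ∷ Γ) = cong₂ _⊔_ (rk-ren ρ α) (maxRk-rens ρ Γ)

∈⇒rk≤maxRk : {Γ : List (Form n)} {α : Form n} → α ∈ Γ → rk α ≤ maxRk Γ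
∈⇒rk≤maxRk {Γ = β ∷ Γ} (here refl) = m≤m⊔n (rk β) (maxRk Γ)
∈⇒rk≤maxRk {Γ = β ∷ Γ} (there i)   =
  ≤-trans (∈⇒rk≤maxRk i) (m≤n⊔m (rk β) (maxRk Γ))

-- The part of `_▷_` that does not unfold fixed points, on open formulas: here complexity drops.
data Child {n : ℕ} : Form n → Form n → Set where
  ⋀ : ∀ {Γ α} → α ∈ Γ → Child (⋀ Γ) α
  ⋁ : ∀ {Γ α} → α ∈ Γ → Child (⋁ Γ) α
  □ : ∀ {α} → Child (□ α) α
  ◇ : ∀ {α} → Child (◇ α) α

Child⇒rk< : {α β : Form n} → Child α β → rk β < rk α
Child⇒rk< (⋀ i) = s≤s (∈⇒rk≤maxRk i)
Child⇒rk< (⋁ i) = s≤s (∈⇒rk≤maxRk i)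
Child⇒rk< □     = ≤-refl
Child⇒rk< ◇     = ≤-refl

Child-sub : (θ : Fin m → Form n) {α β : Form m} →
            Child α β → Child (sub θ α) (sub θ β)
Child-sub θ (⋀ i) = ⋀ (∈-subs⁺ θ i)
Child-sub θ (⋁ i) = ⋁ (∈-subs⁺ θ i)
Child-sub θ □     = □
Child-sub θ ◇     = ◇

data Free {n : ℕ} (i : Fin n) : Form n → Set where
  bvar  : Free i (bvar i)
  child : ∀ {α β} → Child α β → Free i β → Free i α
  fix   : ∀ {σ α} → Free (suc i) α → Free i (fix σ α)

-- Each constructor above the free occurrence adds at least one to the complexity, and weakening `θ`
-- under a binder leaves complexity unchanged.
Free⇒var⊎rk< : {i : Fin m} {α : Form m} (θ : Fin m → Form n) →
           Free i α → α ≡ bvar i ⊎ rk (θ i) < rk (sub θ α)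
Free⇒var⊎rk< θ bvar        = inj₁ refl
Free⇒var⊎rk< θ (child c f) with Free⇒var⊎rk< θ f
... | inj₁ refl = inj₂ (Child⇒rk< (Child-sub θ c))
... | inj₂ lt   = inj₂ (<-trans lt (Child⇒rk< (Child-sub θ c)))
Free⇒var⊎rk< {i = i} θ (fix {σ} {α} f) with Free⇒var⊎rk< (liftSub θ) f
... | inj₁ refl = inj₂ (s≤s (≤-reflexive (sym (rk-ren suc (θ i)))))
... | inj₂ lt   = inj₂ (m<n⇒m<1+n
  (subst (_< rk (sub (liftSub θ) α)) (rk-ren suc (θ i)) lt))

-- Classical reasoning

module Classical (em : ExcludedMiddle (lsuc 0ℓ)) where

  dne : {A : Set₁} → ¬ ¬ A → A
  dne = decidable-stable em

  ¬∀⇒∃¬ : {A : Set} {P : A → Set₁} → ¬ (∀ a → P a) → ∃[ a ] ¬ P a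
  ¬∀⇒∃¬ ¬∀ = dne λ ¬∃ → ¬∀ λ a → dne λ ¬p → ¬∃ (a , ¬p)

  -- Fixed points range over small predicates, while evidence is large; excluded middle makes the
  -- set of worlds that have evidence small.
  Resize : Set₁ → Set
  Resize A = True (em {A})

-- Evidence for truth and falsity

-- Falsity evidence for a μ-formula is a post-fixed point, for a ν-formula
-- a well-founded tree.

dualOn : Side → Binder → Binder
dualOn left  σ = σ
dualOn right μ = ν
dualOn right ν = μ

-- The binder of the threads that count as progress on each side; its evidence there is a
-- well-founded tree.
bad : Side → Binder
bad left  = μ
bad right = ν

dualOn-bad : ∀ s → dualOn s (bad s) ≡ μ
dualOn-bad left  = refl
dualOn-bad right = refl

module Evidence (M : Model) where
  open Model M
  open Semantics M

  Operator : Set₂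
  Operator = Pred World 0ℓ → Pred World (lsuc 0ℓ)

  -- For monotone F this is the least fixed point of F.  Unlike the
  -- intersection of all pre-fixed points, it comes with a well-founded
  -- tree below each of its elements; these trees replace the ordinal
  -- signatures of the usual soundness argument.

  data Tree (F : Operator) (w : World) : Set₁ where
    grow : (P : Pred World 0ℓ) → F P w → (∀ v → P v → Tree F v) → Tree F w

  Fixpoint : Binder → Operator → Pred World (lsuc 0ℓ)
  Fixpoint μ F = Tree F
  Fixpoint ν F w = Σ[ P ∈ Pred World 0ℓ ] (∀ v → P v → F P v) × P w

  -- A common interface to both kinds of evidence: `P` is a set of worlds at which the fixed point
  -- can be entered again, for `μ` with an immediate subtree, for `ν` with the same post-fixed
  -- point.
  unfoldFixpoint : ∀ σ {F w} → Fixpoint σ F w →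
                   Σ[ P ∈ Pred World 0ℓ ] (∀ v → P v → Fixpoint σ F v) × F P w
  unfoldFixpoint μ (grow P f t) = P , t , f
  unfoldFixpoint ν (P , f , p)  = P , (λ v q → P , f , q) , f _ p

  -- Induction on trees. The binder is constrained by an equation because at the point of use it is
  -- known to be `μ` only through a proof.
  unfoldFixpoint-induction : ∀ {F σ} → σ ≡ μ → (C : ∀ w → Fixpoint σ F w → Set₁) →
    (∀ w T → (∀ v p → C v (proj₁ (proj₂ (unfoldFixpoint σ T)) v p)) → C w T) →
    ∀ w T → C w T
  unfoldFixpoint-induction refl C step w T@(grow P f t) =
    step w T λ v p → unfoldFixpoint-induction refl C step v (t v p)

  -- Evidence that α holds (left) or fails (right) at w.

  mutual
    Sem : Side → Form n → Vector (Pred World 0ℓ) n → Pred World (lsuc 0ℓ)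
    Sem s     (bvar i)  ρ w = Lift _ (ρ i w)
    Sem s     (fix σ α) ρ w = Fixpoint (dualOn s σ) (λ P → Sem s α (P ∷ᵛ ρ)) w
    Sem left  (pos x)   ρ w = Lift _ (val x w)
    Sem right (pos x)   ρ w = Lift _ (¬ val x w)
    Sem left  (neg x)   ρ w = Lift _ (¬ val x w)
    Sem right (neg x)   ρ w = Lift _ (val x w)
    Sem left  (□ α)     ρ w = ∀ v → w ⟶ v → Sem left α ρ v
    Sem right (□ α)     ρ w = ∃[ v ] w ⟶ v × Sem right α ρ v
    Sem left  (◇ α)     ρ w = ∃[ v ] w ⟶ v × Sem left α ρ v
    Sem right (◇ α)     ρ w = ∀ v → w ⟶ v → Sem right α ρ v
    Sem left  (⋀ Γ)     ρ w = SemAll left Γ ρ w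
    Sem right (⋀ Γ)     ρ w = SemAny right Γ ρ w
    Sem left  (⋁ Γ)     ρ w = SemAny left Γ ρ w
    Sem right (⋁ Γ)     ρ w = SemAll right Γ ρ w

    SemAll : Side → List (Form n) → Vector (Pred World 0ℓ) n → Pred World (lsuc 0ℓ)
    SemAll s []      ρ w = Lift _ ⊤
    SemAll s (α ∷ Γ) ρ w = Sem s α ρ w × SemAll s Γ ρ w

    SemAny : Side → List (Form n) → Vector (Pred World 0ℓ) n → Pred World (lsuc 0ℓ)
    SemAny s []      ρ w = Lift _ ⊥
    SemAny s (α ∷ Γ) ρ w = Sem s α ρ w ⊎ SemAny s Γ ρ w

  record Closure (s : Side) (ρ : Vector (Pred World 0ℓ) n)
                 (σ : Binder) (φ : Form (suc n)) : Set₁ where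
    constructor closure
    field
      carrier : Pred World 0ℓ
      reenter : ∀ v → carrier v → Sem s (fix σ φ) ρ v

  open Closure

  fix-closure : ∀ s {ρ : Vector (Pred World 0ℓ) n} σ φ {w} →
                Sem s (fix σ φ) ρ w → Closure s ρ σ φ
  fix-closure s σ φ T = let P , r , _ = unfoldFixpoint (dualOn s σ) T in closure P r

  fix-body : ∀ s {ρ : Vector (Pred World 0ℓ) n} σ φ {w} (T : Sem s (fix σ φ) ρ w) →
             Sem s φ (carrier (fix-closure s {ρ} σ φ T) ∷ᵛ ρ) w
  fix-body s σ φ T = proj₂ (proj₂ (unfoldFixpoint (dualOn s σ) T))

  SemAll-lookup : ∀ {s} {Γ : List (Form n)} {α ρ w} →
                  SemAll s Γ ρ w → α ∈ Γ → Sem s α ρ w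
  SemAll-lookup (e , es) (here refl) = e
  SemAll-lookup (e , es) (there i)   = SemAll-lookup es i

  SemAny-find : ∀ {s} (Γ : List (Form n)) {ρ w} →
                SemAny s Γ ρ w → ∃[ α ] α ∈ Γ × Sem s α ρ w
  SemAny-find (α ∷ Γ) (inj₁ e)  = α , here refl , e
  SemAny-find (α ∷ Γ) (inj₂ es) with SemAny-find Γ es
  ... | β , i , e = β , there i , e

  -- From truth and falsity to evidence

  module _ (em : ExcludedMiddle (lsuc 0ℓ)) where
    open Classical em

    mutual
      -- In the case of `μ`, the worlds that carry a tree form a pre-fixed point, which is one of
      -- the sets intersected by the semantics.
      true⇒Sem : {ρ ρ′ : Vector (Pred World 0ℓ) n} → (∀ i w → ρ i w → ρ′ i w) →
                 ∀ α w → ⟦ α ⟧ ρ w → Sem left α ρ′ w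
      true⇒Sem h (pos x)   w t = t
      true⇒Sem h (neg x)   w t = t
      true⇒Sem h (bvar i)  w (lift t) = lift (h i w t)
      true⇒Sem h (□ α)     w t = λ v r → true⇒Sem h α v (t v r)
      true⇒Sem h (◇ α)     w (v , r , t) = v , r , true⇒Sem h α v t
      true⇒Sem h (⋀ Γ)     w t = trueAll⇒Sem h Γ w t
      true⇒Sem h (⋁ Γ)     w t = trueAny⇒Sem h Γ w t
      true⇒Sem {ρ′ = ρ′} h (fix μ α) w t =
        toWitness (t (Resize ∘ Fixpoint μ F) λ v u → fromWitness
          (grow _ (true⇒Sem (λ { zero w → id ; (suc i) → h i }) α v u)
                  (λ v → toWitness)))
        where
        F : Operator
        F P = Sem left α (P ∷ᵛ ρ′)
      true⇒Sem h (fix ν α) w (P , f , p) =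
        P , (λ v q → true⇒Sem (λ { zero w → id ; (suc i) → h i }) α v (f v q)) , p

      trueAll⇒Sem : {ρ ρ′ : Vector (Pred World 0ℓ) n} → (∀ i w → ρ i w → ρ′ i w) →
                    ∀ Γ w → ⟦⋀ Γ ⟧ ρ w → SemAll left Γ ρ′ w
      trueAll⇒Sem h []      w t        = t
      trueAll⇒Sem h (α ∷ Γ) w (t , ts) = true⇒Sem h α w t , trueAll⇒Sem h Γ w ts

      trueAny⇒Sem : {ρ ρ′ : Vector (Pred World 0ℓ) n} → (∀ i w → ρ i w → ρ′ i w) →
                    ∀ Γ w → ⟦⋁ Γ ⟧ ρ w → SemAny left Γ ρ′ w
      trueAny⇒Sem h (α ∷ Γ) w (inj₁ t)  = inj₁ (true⇒Sem h α w t)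
      trueAny⇒Sem h (α ∷ Γ) w (inj₂ ts) = inj₂ (trueAny⇒Sem h Γ w ts)

    mutual
      -- Variables are read by complements. For `μ`, the complement of a pre-fixed point missing `w`
      -- is a post-fixed point of the dual operator. For `ν`, if `w` had no tree, the worlds without
      -- a tree would be a post-fixed point containing `w`.
      false⇒Sem : {ρ ρ′ : Vector (Pred World 0ℓ) n} → (∀ i w → ¬ ρ i w → ρ′ i w) →
                  ∀ α w → ¬ ⟦ α ⟧ ρ w → Sem right α ρ′ w
      false⇒Sem h (pos x)   w f = lift (f ∘ lift)
      false⇒Sem h (neg x)   w f = dne λ ¬v → f (lift (¬v ∘ lift))
      false⇒Sem h (bvar i)  w f = lift (h i w (f ∘ lift))
      false⇒Sem h (□ α)     w f = dne λ ¬∃ → f λ v r → dne λ g →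
        ¬∃ (v , r , false⇒Sem h α v g)
      false⇒Sem h (◇ α)     w f = λ v r → false⇒Sem h α v λ t → f (v , r , t)
      false⇒Sem h (⋀ Γ)     w f = falseAll⇒Sem h Γ w f
      false⇒Sem h (⋁ Γ)     w f = falseAny⇒Sem h Γ w f
      false⇒Sem h (fix μ α) w f = dne λ ¬∃ → f λ P pre → lower (dne {Lift _ (P w)} λ ¬p →
        ¬∃ ( (¬_ ∘ P)
           , (λ v ¬q → false⇒Sem (λ { zero w → id ; (suc i) → h i }) α v (¬q ∘ pre v))
           , ¬p ∘ lift ))
      false⇒Sem {ρ′ = ρ′} h (fix ν α) w f = dne λ ¬T → f
        ( (λ v → Resize (¬ Fixpoint μ F v))
        , (λ v ¬T → dne λ g → toWitness ¬T (grow (Resize ∘ Fixpoint μ F)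
            (false⇒Sem (λ { zero w q → fromWitness (dne (q ∘ fromWitness))
                          ; (suc i) → h i }) α v g)
            (λ v → toWitness)))
        , fromWitness ¬T )
        where
        F : Operator
        F P = Sem right α (P ∷ᵛ ρ′)

      falseAll⇒Sem : {ρ ρ′ : Vector (Pred World 0ℓ) n} → (∀ i w → ¬ ρ i w → ρ′ i w) →
                     ∀ Γ w → ¬ ⟦⋀ Γ ⟧ ρ w → SemAny right Γ ρ′ w
      falseAll⇒Sem h []      w f = ⊥-elim (f (lift tt))
      falseAll⇒Sem {ρ = ρ} h (α ∷ Γ) w f with em {⟦ α ⟧ ρ w}
      ... | yes t = inj₂ (falseAll⇒Sem h Γ w (f ∘ (t ,_)))
      ... | no ¬t = inj₁ (false⇒Sem h α w ¬t)

      falseAny⇒Sem : {ρ ρ′ : Vector (Pred World 0ℓ) n} → (∀ i w → ¬ ρ i w → ρ′ i w) →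
                     ∀ Γ w → ¬ ⟦⋁ Γ ⟧ ρ w → SemAll right Γ ρ′ w
      falseAny⇒Sem h []      w f = lift tt
      falseAny⇒Sem h (α ∷ Γ) w f =
        false⇒Sem h α w (f ∘ inj₁) , falseAny⇒Sem h Γ w (f ∘ inj₂)

  -- Positions of a thread

  module Positions (s : Side) where

    -- The bound variables of a subformula reached by a thread stand for
    -- fixed points which have been unfolded; an environment interprets
    -- each of them by a set of worlds at which that fixed point can be
    -- unfolded again.

    mutual
      data Env : ℕ → Set₁ where
        ε   : Env 0
        _▸_ : (e : Env n) {σ : Binder} {φ : Form (suc n)} →
              Closure s (vals e) σ φ → Env (suc n)

      vals : Env n → Vector (Pred World 0ℓ) n
      vals ε       = []ᵛ
      vals (e ▸ C) = carrier C ∷ᵛ vals e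

    infixl 5 _▸_

    closing : Env n → Fin n → Formula
    closing ε                 = []ᵛ
    closing (_▸_ e {σ} {φ} C) = sub (closing e) (fix σ φ) ∷ᵛ closing e

    Compound : Form n → Set
    Compound (bvar i) = ⊥
    Compound _        = ⊤

    record Pos : Set₁ where
      constructor ⟨_,_,_,_,_⟩
      field
        {size}   : ℕ
        world    : World
        head     : Form size
        env      : Env size
        compound : Compound head
        evidence : Sem s head (vals env) world

    open Pos

    close : Pos → Formula
    close p = sub (closing (env p)) (head p)

    fixpoint : (e : Env n) (σ : Binder) (φ : Form (suc n)) (w : World) →
               Sem s (fix σ φ) (vals e) w → Pos
    fixpoint e σ φ w T = ⟨ w , fix σ φ , e , tt , T ⟩

    pop : (e : Env n) (i : Fin n) (w : World) → vals e i w → Pos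
    pop (_▸_ e {σ} {φ} C) zero    w p = fixpoint e σ φ w (reenter C w p)
    pop (e ▸ C)           (suc i) w p = pop e i w p

    -- The head of a position is never a bound variable: a variable is
    -- replaced at once by its fixed point.  A head containing a fixed
    -- point therefore has strictly greater complexity (rk-compound).

    resume : (α : Form n) (e : Env n) (w : World) → Sem s α (vals e) w → Pos
    resume (bvar i)  e w (lift p) = pop e i w p
    resume (pos x)   e w t = ⟨ w , pos x , e , tt , t ⟩
    resume (neg x)   e w t = ⟨ w , neg x , e , tt , t ⟩
    resume (□ α)     e w t = ⟨ w , □ α , e , tt , t ⟩
    resume (◇ α)     e w t = ⟨ w , ◇ α , e , tt , t ⟩
    resume (⋀ Γ)     e w t = ⟨ w , ⋀ Γ , e , tt , t ⟩
    resume (⋁ Γ)     e w t = ⟨ w , ⋁ Γ , e , tt , t ⟩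
    resume (fix σ α) e w t = fixpoint e σ α w t

    world-pop : (e : Env n) (i : Fin n) {w : World} (p : vals e i w) →
                world (pop e i w p) ≡ w
    world-pop (e ▸ C) zero    p = refl
    world-pop (e ▸ C) (suc i) p = world-pop e i p

    world-resume : (α : Form n) (e : Env n) {w : World} (t : Sem s α (vals e) w) →
                   world (resume α e w t) ≡ w
    world-resume (bvar i)  e (lift p) = world-pop e i p
    world-resume (pos x)   e t = refl
    world-resume (neg x)   e t = refl
    world-resume (□ α)     e t = refl
    world-resume (◇ α)     e t = refl
    world-resume (⋀ Γ)     e t = refl
    world-resume (⋁ Γ)     e t = refl
    world-resume (fix σ α) e t = refl

    close-pop : (e : Env n) (i : Fin n) {w : World} (p : vals e i w) →
                close (pop e i w p) ≡ closing e i
    close-pop (e ▸ C) zero    p = refl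
    close-pop (e ▸ C) (suc i) p = close-pop e i p

    close-resume : (α : Form n) (e : Env n) {w : World} (t : Sem s α (vals e) w) →
                   close (resume α e w t) ≡ sub (closing e) α
    close-resume (bvar i)  e (lift p) = close-pop e i p
    close-resume (pos x)   e t = refl
    close-resume (neg x)   e t = refl
    close-resume (□ α)     e t = refl
    close-resume (◇ α)     e t = refl
    close-resume (⋀ Γ)     e t = refl
    close-resume (⋁ Γ)     e t = refl
    close-resume (fix σ α) e t = refl

    -- `_▷_` lifted to positions. The target is given by an equation because `resume` is a function,
    -- on whose values unification would get stuck.
    data Step : Pos → Pos → Set₁ where
      descend : ∀ {n} {w v} {α β : Form n} {e : Env n} {c t} (u : Sem s β (vals e) v) →
                Child α β → ∀ {q} → q ≡ resume β e v u → Step ⟨ w , α , e , c , t ⟩ q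
      expand  : ∀ {n} {w} {σ} {φ : Form (suc n)} {e : Env n} {c}
                {T : Sem s (fix σ φ) (vals e) w} {q} →
                q ≡ resume φ (e ▸ fix-closure s σ φ T) w (fix-body s σ φ T) →
                Step ⟨ w , fix σ φ , e , c , T ⟩ q

    -- Growth and shrinking of environments

    data _⊑_ : Env m → Env n → Set₁ where
      ⊑-refl : {e : Env n} → e ⊑ e
      ⊑-step : {e : Env m} {e′ : Env n} {σ : Binder} {φ : Form (suc n)}
               {C : Closure s (vals e′) σ φ} →
               e ⊑ e′ → e ⊑ (e′ ▸ C)

    infix 4 _⊑_

    ⊑⇒≤ : {e : Env m} {e′ : Env n} → e ⊑ e′ → m ≤ n
    ⊑⇒≤ ⊑-refl     = ≤-refl
    ⊑⇒≤ (⊑-step h) = m≤n⇒m≤1+n (⊑⇒≤ h)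

    size-pop : (e : Env n) (i : Fin n) {w : World} (p : vals e i w) →
               size (pop e i w p) < n
    size-pop (e ▸ C) zero    p = ≤-refl
    size-pop (e ▸ C) (suc i) p = m<n⇒m<1+n (size-pop e i p)

    -- Returning to a variable discards its entry and all later ones: an entry beyond `e` leaves `e`
    -- intact, one belonging to `e` leaves fewer than `m` entries.
    pop-⊑ : {e : Env m} {e′ : Env n} → e ⊑ e′ → ∀ i {w} (p : vals e′ i w) →
            e ⊑ env (pop e′ i w p) ⊎ size (pop e′ i w p) < m
    pop-⊑ {e = e} ⊑-refl i p = inj₂ (size-pop e i p)
    pop-⊑ (⊑-step h) zero    p = inj₁ h
    pop-⊑ (⊑-step h) (suc i) p = pop-⊑ h i p

    resume-⊑ : {e : Env m} {e′ : Env n} → e ⊑ e′ →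
             ∀ α {w} (t : Sem s α (vals e′) w) →
             e ⊑ env (resume α e′ w t) ⊎ size (resume α e′ w t) < m
    resume-⊑ h (bvar i)  (lift p) = pop-⊑ h i p
    resume-⊑ h (pos x)   t = inj₁ h
    resume-⊑ h (neg x)   t = inj₁ h
    resume-⊑ h (□ α)     t = inj₁ h
    resume-⊑ h (◇ α)     t = inj₁ h
    resume-⊑ h (⋀ Γ)     t = inj₁ h
    resume-⊑ h (⋁ Γ)     t = inj₁ h
    resume-⊑ h (fix σ α) t = inj₁ h

    Step-⊑ : {e : Env m} {p q : Pos} → Step p q → e ⊑ env p → e ⊑ env q ⊎ size q < m
    Step-⊑ (descend {β = β} u c refl) h = resume-⊑ h β u
    Step-⊑ (expand {φ = φ} refl)      h = resume-⊑ (⊑-step h) φ _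

    -- Depends h α: the variable bound by the last entry C of e ▸ C ⊑ e′
    -- is reached from α through the fixed points recorded in e′.

    mutual
      Reaches : {e : Env m} {e′ : Env n} {σ : Binder} {φ : Form (suc m)}
                {C : Closure s (vals e) σ φ} → e ▸ C ⊑ e′ → Fin n → Set
      Reaches ⊑-refl               zero    = ⊤
      Reaches ⊑-refl               (suc i) = ⊥
      Reaches (⊑-step {σ = σ} {φ} h) zero    = Depends h (fix σ φ)
      Reaches (⊑-step h)           (suc i) = Reaches h i

      Depends : {e : Env m} {e′ : Env n} {σ : Binder} {φ : Form (suc m)}
                {C : Closure s (vals e) σ φ} → e ▸ C ⊑ e′ → Form n → Set
      Depends h α = ∃[ i ] Free i α × Reaches h i

    rk-compound : {α : Form m} (θ : Fin m → Form n) → Compound α →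
                  ∀ {i} → Free i α → rk (θ i) < rk (sub θ α)
    rk-compound θ c f with Free⇒var⊎rk< θ f
    ... | inj₁ refl = ⊥-elim c
    ... | inj₂ lt = lt

    module _ {e : Env m} {σ : Binder} {φ : Form (suc m)} where

      private
        X : Formula
        X = sub (closing e) (fix σ φ)

      -- Every link of the chain is a `fix`, hence compound, so its closed form is more complex than
      -- that of any of its free variables.
      Reaches⇒rk≤ : {C : Closure s (vals e) σ φ} {e′ : Env n} (h : e ▸ C ⊑ e′) →
                    ∀ i → Reaches h i → rk X ≤ rk (closing e′ i)
      Reaches⇒rk≤ ⊑-refl     zero    r = ≤-refl
      Reaches⇒rk≤ (⊑-step {e′ = e′} h) zero (i , f , r) =
        ≤-trans (Reaches⇒rk≤ h i r) (<⇒≤ (rk-compound (closing e′) tt f))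
      Reaches⇒rk≤ (⊑-step h) (suc i) r = Reaches⇒rk≤ h i r

      Depends⇒rk< : {C : Closure s (vals e) σ φ} (p : Pos) (h : e ▸ C ⊑ env p) →
                    Depends h (head p) → rk X < rk (close p)
      Depends⇒rk< p h (i , f , r) =
        ≤-<-trans (Reaches⇒rk≤ h i r) (rk-compound (closing (env p)) (compound p) f)

      -- A thread that unfolds the formula fix σ φ at e stays above e ▸ C,
      -- until it returns to fix σ φ at e or leaves e.

      data Next (C : Closure s (vals e) σ φ) (D : Set) (q : Pos) : Set₁ where
        inside  : (h : e ▸ C ⊑ env q) → (Depends h (head q) → D) → Next C D q
        returns : ∀ v p → q ≡ fixpoint e σ φ v (reenter C v p) → D → Next C D q
        leaves  : size q < m → Next C D q

      Next-map : ∀ {C D D′ q} → (D → D′) → Next C D q → Next C D′ q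
      Next-map f (inside h g)       = inside h (f ∘ g)
      Next-map f (returns v p eq d) = returns v p eq (f d)
      Next-map f (leaves lt)        = leaves lt

      next-pop : ∀ {C} {e′ : Env n} (h : e ▸ C ⊑ e′) i {w} (p : vals e′ i w) →
                 Next C (Reaches h i) (pop e′ i w p)
      next-pop ⊑-refl     zero    p = returns _ p refl tt
      next-pop ⊑-refl     (suc i) p = leaves (size-pop e i p)
      next-pop (⊑-step h) zero    p = inside h id
      next-pop (⊑-step h) (suc i) p = next-pop h i p

      next-resume : ∀ {C} {e′ : Env n} (h : e ▸ C ⊑ e′) α {w}
                    (t : Sem s α (vals e′) w) →
                    Next C (Depends h α) (resume α e′ w t)
      next-resume h (bvar i) (lift p) = Next-map (λ r → i , bvar , r) (next-pop h i p)
      next-resume h (pos x)   t = inside h id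
      next-resume h (neg x)   t = inside h id
      next-resume h (□ α)     t = inside h id
      next-resume h (◇ α)     t = inside h id
      next-resume h (⋀ Γ)     t = inside h id
      next-resume h (⋁ Γ)     t = inside h id
      next-resume h (fix _ α) t = inside h id

      -- Dependence is passed backwards. A variable free in a child is free in the parent; the
      -- variable bound by an expanded fixed point reaches `C` exactly if that fixed point depends
      -- on it.
      next-step : ∀ {C p q} (h : e ▸ C ⊑ env p) → Step p q →
                  Next C (Depends h (head p)) q
      next-step h (descend {β = β} u c refl) =
        Next-map (λ (i , f , r) → i , child c f , r) (next-resume h β u)
      next-step h (expand {φ = ψ} refl) =
        Next-map (λ { (zero , f , j , g , r) → j , g , r
                    ; (suc i , f , r) → i , fix f , r })
                 (next-resume (⊑-step h) ψ _)

    resume-self : ∀ p → resume (head p) (env p) (world p) (evidence p) ≡ p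
    resume-self ⟨ w , pos x , e , c , t ⟩   = refl
    resume-self ⟨ w , neg x , e , c , t ⟩   = refl
    resume-self ⟨ w , □ α , e , c , t ⟩     = refl
    resume-self ⟨ w , ◇ α , e , c , t ⟩     = refl
    resume-self ⟨ w , ⋀ Γ , e , c , t ⟩     = refl
    resume-self ⟨ w , ⋁ Γ , e , c , t ⟩     = refl
    resume-self ⟨ w , fix σ α , e , c , t ⟩ = refl

    Step-fixpoint : ∀ {e : Env n} {σ φ w T q} → Step (fixpoint e σ φ w T) q →
                    q ≡ resume φ (e ▸ fix-closure s σ φ T) w (fix-body s σ φ T)
    Step-fixpoint (descend _ () _)
    Step-fixpoint (expand eq) = eq

    next-fixpoint : ∀ {e : Env n} {σ φ w T q} → Step (fixpoint e σ φ w T) q →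
                    Next (fix-closure s σ φ T) ⊤ q
    next-fixpoint {φ = φ} st with Step-fixpoint st
    ... | refl = Next-map (λ _ → tt) (next-resume ⊑-refl φ _)

    -- Infinite runs of positions

    module Run
      (em : ExcludedMiddle (lsuc 0ℓ))
      (p : ℕ → Pos) (steps : ∀ i → Step (p i) (p (suc i)))
      (body : Form 1)
      (infinite : InfinitelyOften (close ∘ p) (fix (bad s) body))
      (minimal : ∀ β → InfinitelyOften (close ∘ p) β → rk (fix (bad s) body) ≤ rk β)
      where
      open Classical em

      step-from : ∀ {i q} → p i ≡ q → Step q (p (suc i))
      step-from {i} eq = subst (λ q → Step q (p (suc i))) eq (steps i)

      module Recurrence
        {e : Env n} {σ : Binder} {φ : Form (suc n)} {i₀ : ℕ}
        (above : ∀ j → i₀ ≤ j → e ⊑ env (p j))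
        where

        Visit : ∀ w → Sem s (fix σ φ) (vals e) w → ℕ → Set₁
        Visit w T j = p j ≡ fixpoint e σ φ w T

        Inside : Closure s (vals e) σ φ → ℕ → Set₁
        Inside C j = e ▸ C ⊑ env (p j)

        Revisit : Closure s (vals e) σ φ → ℕ → Set₁
        Revisit C j = ∃[ k ] j < k × ∃[ v ] ∃[ q ] Visit v (reenter C v q) k

        stays : ∀ {j} → i₀ ≤ j → ¬ size (p (suc j)) < n
        stays i₀≤j lt = <⇒≱ lt (⊑⇒≤ (above _ (m≤n⇒m≤1+n i₀≤j)))

        -- Induction on the distance to a time outside `C`. Since `e` is never abandoned, the only
        -- way out is a return through `reenter C`, and the dependence is collected on the way back.
        returning : ∀ {C} d {j} → i₀ ≤ j → (h : Inside C j) → ¬ Inside C (d + j) →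
                    Depends h (head (p j)) × Revisit C j
        returning zero h≤ h out = ⊥-elim (out h)
        returning {C} (suc d) {j} i₀≤j h out with next-step h (steps j)
        ... | leaves lt         = ⊥-elim (stays i₀≤j lt)
        ... | returns v q eq D  = D , suc j , ≤-refl , v , q , eq
        ... | inside h′ f
          with D , k , lt , visit ← returning d (m≤n⇒m≤1+n i₀≤j) h′
                                      (subst (¬_ ∘ Inside C) (sym (+-suc d j)) out)
          = f D , k , <-trans ≤-refl lt , visit

        module _
          (exits : ∀ {w T j} → i₀ ≤ j → Visit w T j →
                   ∃[ d ] ¬ Inside (fix-closure s σ φ T) (d + suc j))
          {w₀ : World} {T₀ : Sem s (fix σ φ) (vals e) w₀} (visit₀ : Visit w₀ T₀ i₀)
          where

          -- The invariant of the run from `i₀` on. The number `d` counts down to a time outside the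
          -- current closure; a new visit resets it by `exits`.
          data Status (j : ℕ) : Set₁ where
            visiting : ∀ {w T} → Visit w T j → Status j
            within   : ∀ {C} d → Inside C j → ¬ Inside C (d + j) → Status j

          status-next : ∀ {C D j} → i₀ ≤ j → Next C D (p (suc j)) →
                        ∀ d → ¬ Inside C (d + suc j) → Status (suc j)
          status-next i₀≤j (inside h _)        d out = within d h out
          status-next i₀≤j (returns v q eq _)  d out = visiting eq
          status-next i₀≤j (leaves lt)         d out = ⊥-elim (stays i₀≤j lt)

          next-visit : ∀ {w T j} → Visit w T j → Next (fix-closure s σ φ T) ⊤ (p (suc j))
          next-visit eq = next-fixpoint (step-from eq)

          status-suc : ∀ {j} → i₀ ≤ j → Status j → Status (suc j)
          status-suc i₀≤j (visiting eq) =
            let d , out = exits i₀≤j eq in status-next i₀≤j (next-visit eq) d out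
          status-suc i₀≤j (within zero h out) = ⊥-elim (out h)
          status-suc {j} i₀≤j (within {C} (suc d) h out) =
            status-next i₀≤j (next-step h (steps j)) d
              (subst (¬_ ∘ Inside C) (sym (+-suc d j)) out)

          status : ∀ j → Status (j + i₀)
          status zero    = visiting visit₀
          status (suc j) = status-suc (m≤n+m i₀ j) (status j)

          X : Formula
          X = sub (closing e) (fix σ φ)

          X-infinite : InfinitelyOften (close ∘ p) X
          X-infinite k with status k
          ... | visiting eq    = k + i₀ , m≤m+n k i₀ , cong close eq
          ... | within d h out =
            let _ , j , lt , _ , _ , eq = returning d (m≤n+m i₀ k) h out
            in j , ≤-trans (m≤m+n k i₀) (<⇒≤ lt) , cong close eq

          -- The formula of minimal complexity occurs at some time after `i₀`. Inside a closure it
          -- would be strictly more complex than `X`, which also recurs, against minimality; so it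
          -- occurs at a visit.
          σ-bad : σ ≡ bad s
          σ-bad with infinite i₀
          ... | j , i₀≤j , eq with m≤n⇒∃[o]m+o≡n i₀≤j
          ... | d , refl with subst Status (+-comm d i₀) (status d)
          -- Both formulas are fixed points, so their equality identifies the binders.
          ... | visiting v with refl ← trans (sym eq) (cong close v) = refl
          ... | within d′ h out =
            ⊥-elim (<⇒≱ (subst (rk X <_) (cong rk eq)
                          (Depends⇒rk< (p (i₀ + d)) h (proj₁ (returning d′ i₀≤j h out))))
                        (minimal X X-infinite))

          revisit : ∀ {w T j} → i₀ ≤ j → Visit w T j → Revisit (fix-closure s σ φ T) j
          revisit i₀≤j eq with next-visit eq
          ... | leaves lt        = ⊥-elim (stays i₀≤j lt)
          ... | returns v q eq _ = _ , ≤-refl , v , q , eq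
          ... | inside h _       =
            let d , out = exits i₀≤j eq
                _ , k , lt , visit = returning d (m≤n⇒m≤1+n i₀≤j) h out
            in k , <-trans ≤-refl lt , visit

          -- Each visit is followed by one whose evidence is an immediate subtree of the present
          -- evidence, as `σ-bad` makes the evidence a tree.
          impossible : ⊥
          impossible = lower (unfoldFixpoint-induction
            (trans (cong (dualOn s) σ-bad) (dualOn-bad s))
            (λ w T → ∀ j → i₀ ≤ j → Visit w T j → Lift (lsuc 0ℓ) ⊥)
            (λ w T ih j i₀≤j eq →
              let k , j<k , v , q , eq′ = revisit i₀≤j eq
              in ih v q k (≤-trans i₀≤j (<⇒≤ j<k)) eq′)
            w₀ T₀ i₀ ≤-refl visit₀)

      -- Induction on the bound `b` for the complexity of `α`, with `e` varying: a variable falls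
      -- below `e` at once, and a child is less complex over the same `e`.
      ¬above : ∀ b {n} {e : Env n} {α w t i} → rk α < b → p i ≡ resume α e w t →
               ¬ (∀ j → i ≤ j → e ⊑ env (p j))
      ¬above-Child : ∀ b {n} {e : Env n} {α w c t i} → rk α ≤ b →
                     p i ≡ ⟨ w , α , e , c , t ⟩ → (∀ {σ φ} → ¬ (α ≡ fix σ φ)) →
                     ¬ (∀ j → i ≤ j → e ⊑ env (p j))

      ¬above-Child b {i = i} lt eq nf above with step-from eq
      ... | descend u c eq′ =
        ¬above b (<-≤-trans (Child⇒rk< c) lt) eq′ (λ j le → above j (<⇒≤ le))
      ... | expand _ = nf refl

      ¬above (suc b) {e = e} {bvar x} {t = lift q} {i} lt eq above =
        <⇒≱ (subst (λ r → size r < _) (sym eq) (size-pop e x q)) (⊑⇒≤ (above i ≤-refl))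
      ¬above (suc b) {α = pos x} (s≤s lt) eq = ¬above-Child b lt eq λ ()
      ¬above (suc b) {α = neg x} (s≤s lt) eq = ¬above-Child b lt eq λ ()
      ¬above (suc b) {α = □ α}   (s≤s lt) eq = ¬above-Child b lt eq λ ()
      ¬above (suc b) {α = ◇ α}   (s≤s lt) eq = ¬above-Child b lt eq λ ()
      ¬above (suc b) {α = ⋀ Γ}   (s≤s lt) eq = ¬above-Child b lt eq λ ()
      ¬above (suc b) {α = ⋁ Γ}   (s≤s lt) eq = ¬above-Child b lt eq λ ()
      ¬above (suc b) {e = e} {fix σ φ} {i = i} (s≤s lt) eq above
        -- Either some visit opens a closure that is never left, and the less complex body continues
        -- over the longer environment, or every visit has an exit and the fixed point recurs.
        with em {∃[ j ] i ≤ j × ∃[ w ] ∃[ T ] p j ≡ fixpoint e σ φ w T ×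
                 (∀ k → j < k → e ▸ fix-closure s σ φ T ⊑ env (p k))}
      ... | yes (j , _ , w , T , eq′ , stays) =
        ¬above b lt (Step-fixpoint (step-from eq′)) stays
      ... | no never = Recurrence.impossible above
        (λ {w} {T} {j} i≤j v → ¬∀⇒∃¬ λ all →
          never (j , i≤j , w , T , v , λ k j<k →
            let d , eq = m≤n⇒∃[o]m+o≡n j<k
            in subst (λ k → e ▸ fix-closure s σ φ T ⊑ env (p k))
                 (trans (+-comm d (suc j)) eq) (all d)))
        eq

      -- Induction on the size of the environment: a later drop below the current size is excluded
      -- by the induction hypothesis, so the current environment persists forever, against `¬above`.
      impossible : ⊥
      impossible = go _ 0 ≤-refl
        where
        go : ∀ b i → size (p i) < b → ⊥
        go (suc b) i (s≤s lt) =
          ¬above _ {α = head (p i)} {t = evidence (p i)}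
                 ≤-refl (sym (resume-self (p i))) λ j i≤j →
            let d , eq = m≤n⇒∃[o]m+o≡n i≤j
            in subst (λ k → env (p i) ⊑ env (p k)) (trans (+-comm d i) eq) (stay d)
          where
          stay : ∀ d → env (p i) ⊑ env (p (d + i))
          stay zero    = ⊑-refl
          stay (suc d) with Step-⊑ (steps (d + i)) (stay d)
          ... | inj₁ h   = h
          ... | inj₂ lt′ = ⊥-elim (go b (suc d + i) (<-≤-trans lt′ lt))

    -- Moves of tracked formulas

    Track : Formula → World → Set₁
    Track α w = Σ[ q ∈ Pos ] world q ≡ w × close q ≡ α

    Move : Pos → Formula → World → Set₁
    Move q α w = Σ[ (q′ , _) ∈ Track α w ] Step q q′

    descending : ∀ {α β : Form n} {w v e c t} → Child α β → Sem s β (vals e) v →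
                 Move ⟨ w , α , e , c , t ⟩ (sub (closing e) β) v
    descending {β = β} {e = e} i u =
      (resume β e _ u , world-resume β e u , close-resume β e u) , descend u i refl

    move-all : ∀ {Γ : List (Form n)} {w e α c t β} → SemAll s Γ (vals e) w →
               (∀ {γ} → γ ∈ Γ → Child α γ) → β ∈ subs (closing e) Γ →
               Move ⟨ w , α , e , c , t ⟩ β w
    move-all {Γ = Γ} {e = e} es c i with ∈-subs⁻ (closing e) Γ i
    ... | γ , j , refl = descending (c j) (SemAll-lookup es j)

    move-any : ∀ {Γ : List (Form n)} {w e α c t} → SemAny s Γ (vals e) w →
               (∀ {γ} → γ ∈ Γ → Child α γ) →
               Σ[ (β , _) ∈ Occ (subs (closing e) Γ) ] Move ⟨ w , α , e , c , t ⟩ β w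
    move-any {Γ = Γ} {e = e} es c with SemAny-find Γ es
    ... | γ , j , u = (_ , ∈-subs⁺ (closing e) j) , descending (c j) u

    move-fix : ∀ {σ φ w} (t : Track (fix σ φ) w) → Move (proj₁ t) (φ [ fix σ φ ]) w
    move-fix (⟨ w , fix σ φ , e , c , T ⟩ , refl , refl) =
      ( resume φ e′ w t , world-resume φ e′ t
      , trans (close-resume φ e′ t) (sym (sub-∷ _ (closing e) φ)) ) , expand refl
      where
      e′ = e ▸ fix-closure s σ φ T
      t  = fix-body s σ φ T

  open Positions

  move-⋀ˡ : ∀ {Γ β w} (t : Track left (⋀ Γ) w) → β ∈ Γ → Move left (proj₁ t) β w
  move-⋀ˡ (⟨ w , ⋀ Γ , e , c , t ⟩ , refl , refl) = move-all left t ⋀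

  move-⋁ˡ : ∀ {Γ w} (t : Track left (⋁ Γ) w) →
            Σ[ (β , _) ∈ Occ Γ ] Move left (proj₁ t) β w
  move-⋁ˡ (⟨ w , ⋁ Γ , e , c , t ⟩ , refl , refl) = move-any left t ⋁

  move-⋁ʳ : ∀ {Γ β w} (t : Track right (⋁ Γ) w) → β ∈ Γ → Move right (proj₁ t) β w
  move-⋁ʳ (⟨ w , ⋁ Γ , e , c , t ⟩ , refl , refl) = move-all right t ⋁

  move-⋀ʳ : ∀ {Γ w} (t : Track right (⋀ Γ) w) →
            Σ[ (β , _) ∈ Occ Γ ] Move right (proj₁ t) β w
  move-⋀ʳ (⟨ w , ⋀ Γ , e , c , t ⟩ , refl , refl) = move-any right t ⋀

  move-□ˡ : ∀ {α w v} (t : Track left (□ α) w) → w ⟶ v → Move left (proj₁ t) α v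
  move-□ˡ (⟨ w , □ α , e , c , t ⟩ , refl , refl) r = descending left □ (t _ r)

  move-◇ˡ : ∀ {α w} (t : Track left (◇ α) w) → ∃[ v ] w ⟶ v × Move left (proj₁ t) α v
  move-◇ˡ (⟨ w , ◇ α , e , c , (v , r , t) ⟩ , refl , refl) = v , r , descending left ◇ t

  move-◇ʳ : ∀ {α w v} (t : Track right (◇ α) w) → w ⟶ v → Move right (proj₁ t) α v
  move-◇ʳ (⟨ w , ◇ α , e , c , t ⟩ , refl , refl) r = descending right ◇ (t _ r)

  move-□ʳ : ∀ {α w} (t : Track right (□ α) w) → ∃[ v ] w ⟶ v × Move right (proj₁ t) α v
  move-□ʳ (⟨ w , □ α , e , c , (v , r , t) ⟩ , refl , refl) = v , r , descending right □ t

  literal-posˡ : ∀ {x w} → Track left (pos x) w → val x w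
  literal-posˡ (⟨ w , pos x , e , c , t ⟩ , refl , refl) = lower t

  literal-negˡ : ∀ {x w} → Track left (neg x) w → ¬ val x w
  literal-negˡ (⟨ w , neg x , e , c , t ⟩ , refl , refl) = lower t

  literal-posʳ : ∀ {x w} → Track right (pos x) w → ¬ val x w
  literal-posʳ (⟨ w , pos x , e , c , t ⟩ , refl , refl) = lower t

  literal-negʳ : ∀ {x w} → Track right (neg x) w → val x w
  literal-negʳ (⟨ w , neg x , e , c , t ⟩ , refl , refl) = lower t

  -- Countermodel branches

  -- Evidence that `S` fails at `w`, with a separate position for each occurrence.
  State : Sequent → World → Set₁
  State S w = ∀ s (o : Occ (S at s)) → Track s (proj₁ o) w

  -- At rest the whole position is kept, evidence included, so the principal moves of a trace join
  -- into one run.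
  record Link (s : Side) (minor : Set) (q q′ : Pos s) : Set₁ where
    constructor link
    field
      moves : minor → Step s q q′
      rests : ¬ minor → q ≡ q′

  Successor : ∀ {S w} → Rule S → State S w → Set₁
  Successor r st =
    Σ[ i ∈ Premise r ] Σ[ v ∈ World ] ∀ s o →
      Σ[ t ∈ Track s (proj₁ o) v ]
        Link s (IsMinor r i s o) (proj₁ (st s (origin r i s o))) (proj₁ t)

  resting : ∀ {s α w} {minor : Set} (t : Track s α w) → ¬ minor →
            Σ[ t′ ∈ Track s α w ] Link s minor (proj₁ t) (proj₁ t′)
  resting t ¬m = t , link (⊥-elim ∘ ¬m) (λ _ → refl)

  moving : ∀ {s α w minor q} → minor → Move s q α w →
           Σ[ t ∈ Track s α w ] Link s minor q (proj₁ t)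
  moving m (t , st) = t , link (λ _ → st) (λ ¬m → ⊥-elim (¬m m))

  -- Evidence for the principal formula selects the premise in `⋁L` and `⋀R` and the next world in
  -- the modal rules; at an axiom the evidence is contradictory.
  successor : ∀ {S w} (r : Rule S) (st : State S w) → Successor r st
  successor (exchangeL p) st = tt , _ , λ
    { left o → resting (st left (permOcc p o)) id ; right o → resting (st right o) id }
  successor (exchangeR p) st = tt , _ , λ
    { left o → resting (st left o) id ; right o → resting (st right (permOcc p o)) id }
  successor contractL st = tt , _ , λ
    { left  (_ , here i)  → resting (st left (_ , here i)) id
    ; left  (_ , there i) → resting (st left (_ , i)) id
    ; right o             → resting (st right o) id }
  successor contractR st = tt , _ , λ
    { left  o             → resting (st left o) id
    ; right (_ , here i)  → resting (st right (_ , here i)) id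
    ; right (_ , there i) → resting (st right (_ , i)) id }
  successor weakenL st = tt , _ , λ
    { left o → resting (st left (tailOcc o)) id ; right o → resting (st right o) id }
  successor weakenR st = tt , _ , λ
    { left o → resting (st left o) id ; right o → resting (st right (tailOcc o)) id }
  successor (⋀L i) st = tt , _ , λ
    { left  (_ , here refl) → moving isHead (move-⋀ˡ (st left (_ , here refl)) i)
    ; left  (_ , there j)   → resting (st left (_ , there j)) λ ()
    ; right o               → resting (st right o) id }
  successor ⋁L st = let o , move = move-⋁ˡ (st left (_ , here refl)) in o , _ , λ
    { left  (_ , here refl) → moving isHead move
    ; left  (_ , there j)   → resting (st left (_ , there j)) λ ()
    ; right o               → resting (st right o) id }
  successor fixL st = tt , _ , λ
    { left  (_ , here refl) → moving isHead (move-fix left (st left (_ , here refl)))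
    ; left  (_ , there j)   → resting (st left (_ , there j)) λ ()
    ; right o               → resting (st right o) id }
  successor ◇L st = let v , r , move = move-◇ˡ (st left (_ , here refl)) in tt , v , λ
    { left  (_ , here refl) → moving tt move
    ; left  (_ , there j)   → moving tt (move-□ˡ (st left (tailOcc (mapOcc □ (_ , j)))) r)
    ; right o               → moving tt (move-◇ʳ (st right (mapOcc ◇ o)) r) }
  successor ⋀R st = let o , move = move-⋀ʳ (st right (_ , here refl)) in o , _ , λ
    { left  o               → resting (st left o) id
    ; right (_ , here refl) → moving isHead move
    ; right (_ , there j)   → resting (st right (_ , there j)) λ () }
  successor (⋁R i) st = tt , _ , λ
    { left  o               → resting (st left o) id
    ; right (_ , here refl) → moving isHead (move-⋁ʳ (st right (_ , here refl)) i)
    ; right (_ , there j)   → resting (st right (_ , there j)) λ () }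
  successor fixR st = tt , _ , λ
    { left  o               → resting (st left o) id
    ; right (_ , here refl) → moving isHead (move-fix right (st right (_ , here refl)))
    ; right (_ , there j)   → resting (st right (_ , there j)) λ () }
  successor □R st = let v , r , move = move-□ʳ (st right (_ , here refl)) in tt , v , λ
    { left  o               → moving tt (move-□ˡ (st left (mapOcc □ o)) r)
    ; right (_ , here refl) → moving tt move
    ; right (_ , there j)   → moving tt (move-◇ʳ (st right (tailOcc (mapOcc ◇ (_ , j)))) r) }
  successor (axiomL x) st =
    ⊥-elim (literal-negˡ (st left (_ , there (here refl)))
                         (literal-posˡ (st left (_ , here refl))))
  successor (axiomR x) st =
    ⊥-elim (literal-posʳ (st right (_ , here refl))
                         (literal-negʳ (st right (_ , there (here refl)))))
  successor (axiomLR x) st =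
    ⊥-elim (literal-posʳ (st right (_ , here refl))
                         (literal-posˡ (st left (_ , here refl))))

  record Failing : Set₁ where
    constructor failing
    field
      node  : Node
      world : World
      state : State (proj₁ node) world

  open Failing

  next-failing : Failing → Failing
  next-failing (failing (S , d) w st) =
    let i , v , st′ = successor (rule d) st
    in failing (premise (rule d) i , next d i) v (λ s o → proj₁ (st′ s o))

  failing-step : ∀ f → node f ↝ node (next-failing f)
  failing-step (failing (S , d) w st) = child (proj₁ (successor (rule d) st))

  failing-link : ∀ f s o → Link s (PrincipalMove s (failing-step f) o)
    (proj₁ (state f s (originAt s (failing-step f) o)))
    (proj₁ (state (next-failing f) s o))
  failing-link (failing (S , d) w st) s o =
    proj₂ (proj₂ (proj₂ (successor (rule d) st)) s o)

  module CounterBranch {S} (d : Derivation S) {w₀} (st₀ : State S w₀) where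

    stage : ℕ → Failing
    stage zero    = failing (S , d) w₀ st₀
    stage (suc i) = next-failing (stage i)

    branch : Branch d
    branch = record
      { node  = node ∘ stage
      ; start = refl
      ; step  = failing-step ∘ stage
      }

    -- Positions along a trace

    module Following {s : Side} (τ : Trace branch s) where
      open Trace τ

      follow : ℕ → Pos s
      follow i = proj₁ (state (stage (i + base)) s (occ i))

      follow-close : ∀ i → close s (follow i) ≡ formula i
      follow-close i = proj₂ (proj₂ (state (stage (i + base)) s (occ i)))

      follow-link : ∀ i → Link s (Principal i) (follow i) (follow (suc i))
      follow-link i =
        subst (λ o → Link s (Principal i) (proj₁ (state (stage (i + base)) s o))
                                          (follow (suc i)))
          (follows i) (failing-link (stage (i + base)) s (occ (suc i)))

      module _ {t : ℕ → Formula} (supports : Supports branch τ t) where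
        open Supports supports

        increasing⇒mono : ∀ {j k} → j ≤ k → position j ≤ position k
        increasing⇒mono {j} {zero}  z≤n = ≤-refl
        increasing⇒mono {j} {suc k} j≤k with m≤n⇒m<n∨m≡n j≤k
        ... | inj₁ (s≤s j≤k′) = ≤-trans (increasing⇒mono j≤k′) (<⇒≤ (increasing k))
        ... | inj₂ refl       = ≤-refl

        between : ∀ k {i} → position k < i → i < position (suc k) → ¬ Principal i
        between k {i} k<i i<k P with complete i P
        ... | j , refl with ≤-<-connex j k
        ... | inj₁ j≤k = <⇒≱ k<i (increasing⇒mono j≤k)
        ... | inj₂ k<j = <⇒≱ i<k (increasing⇒mono k<j)

        rest : ∀ k d {i} → d + i ≡ position (suc k) → position k < i →
               follow i ≡ follow (position (suc k))
        rest k zero    eq k<i = cong follow eq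
        rest k (suc d) {i} eq k<i =
          trans (Link.rests (follow-link i)
                   (between k k<i (subst (i <_) eq (s≤s (m≤n+m i d)))))
                (rest k d (trans (+-suc d i) eq) (m≤n⇒m≤1+n k<i))

        -- The principal move ends at `suc (position k)`; from there the position rests until the
        -- next principal move, since `complete` rules out any in between.
        follow-step : ∀ k → Step s (follow (position k)) (follow (position (suc k)))
        follow-step k =
          let d , eq = m≤n⇒∃[o]m+o≡n (increasing k)
          in subst (Step s _) (rest k d (trans (+-comm d _) eq) ≤-refl)
               (Link.moves (follow-link (position k)) (sound k))

        thread-close : ∀ k → close s (follow (position k)) ≡ t k
        thread-close k = trans (follow-close (position k)) (sym (records k))

    ¬Carries : ExcludedMiddle (lsuc 0ℓ) → ∀ s → ¬ Carries branch s (bad s)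
    ¬Carries em s (τ , t , supports , isThread) =
      Run.impossible s em (follow ∘ Supports.position supports) (follow-step supports) body
        (λ k → let i , k≤i , eq = infinite k in i , k≤i , trans (thread-close supports i) eq)
        (λ β inf → minimal β λ k →
          let i , k≤i , eq = inf k in i , k≤i , trans (sym (thread-close supports i)) eq)
      where
      open Following τ
      open IsThread isThread

-- Soundness of co-proofs

theorem3p4 : ExcludedMiddle (lsuc 0ℓ) →
    (Φ Ψ : List Formula) → CoProof (Φ ⇒ Ψ) →
    (M : Model) → All (M ⊨_) Φ → Any (M ⊨_) Ψ
theorem3p4 em Φ Ψ π M all = dne λ ¬any →
  let open CounterBranch (CoProof.derivation π) (state ¬any)
  in [ ¬Carries em left , ¬Carries em right ]′ (CoProof.progress π branch)
  where
  open Classical em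
  open Model M
  open Evidence M
  open Positions

  track : ∀ s {α} → Sem s α []ᵛ root → Track s α root
  track s {α} t =
    resume s α ε root t , world-resume s α ε t ,
    trans (close-resume s α ε t) (sub-id (λ ()) α)

  state : ¬ Any (M ⊨_) Ψ → State (Φ ⇒ Ψ) root
  state ¬any left  (α , i) = track left (true⇒Sem em (λ ()) α root (lookup all i))
  state ¬any right (α , i) =
    track right (false⇒Sem em (λ ()) α root (¬any ∘ lose i))
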